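{- The set $R^+_{ure}$ of all $e$ such that $\mathrm{RTD}^+(\mathcal L_e)$ is finite and witnessed by a uniformly r.e. positive teaching sequence for $\mathcal L_e$ is $\Sigma^0_5$-hard.
   Context: $W_0,W_1,\ldots$ is an acceptable numbering of all r.e. subsets of $\mathbb N$; $L^e_j = \{x : \langle j,x\rangle \in W_e\}$ and $\mathcal L_e = \{L^e_j : j\in\mathbb N\}$. A positive teaching sequence for a family $\mathcal L$ is a sequence $((\mathcal F_0,d_0),(\mathcal F_1,d_1),\ldots)$ (indexed by an initial segment of $\mathbb N$) such that (i) the $\mathcal F_i$ are nonempty and form a partition of $\mathcal L$, and (ii) for every $i$ and every $L\in\mathcal F_i$ there is $S_L\subseteq L$ with $|S_L| = d_i<\infty$ such that for all $L'\in\bigcup_{j\geq i}\mathcal F_j$, $S_L\subseteq L'$ implies $L=L'$. Its order is $\sup_i d_i$, and $\mathrm{RTD}^+(\mathcal L)$ is the infimum of orders of positive teaching sequences for $\mathcal L$. The sequence is uniformly r.e. if the families $\mathcal F_i$ are uniformly r.e., i.e. there is an r.e. set $W$ with $\mathcal F_i = \{\{x : \langle i,j,x\rangle\in W\} : j\in\mathbb N\}$ for all $i$. "Finite and witnessed by" means there is such a uniformly r.e. positive teaching sequence of finite order. A set is $\Sigma^0_5$-hard if every $\Sigma^0_5$ set many-one reduces to it via a recursive function. -}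

module Defs where

open import Level using (0ℓ)
open import Data.Nat using (ℕ; zero; suc; _+_; _*_; _/_; _<_; _≤_)
open import Data.Fin using (Fin; toℕ)
open import Data.Vec using (Vec; []; _∷_; lookup)
open import Data.List using (List; length)
open import Data.List.Relation.Unary.All using (All)
open import Data.List.Relation.Unary.Unique.Propositional using (Unique)
open import Data.Maybe using (Maybe; just; nothing)
open import Data.Product using (Σ; _×_; _,_)
open import Data.Unit using (⊤)
open import Relation.Binary.PropositionalEquality using (_≡_)

pair : ℕ → ℕ → ℕ
pair x y = ((x + y) * suc (x + y)) / 2 + y

triple : ℕ → ℕ → ℕ → ℕ
triple i j x = pair i (pair j x)

data PR : ℕ → Set where
  zer  : ∀ {n} → PR n
  succ : PR 1
  proj : ∀ {n} → Fin n → PR n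
  comp : ∀ {n m} → PR m → Vec (PR n) m → PR n
  prec : ∀ {n} → PR n → PR (suc (suc n)) → PR (suc n)
  mu   : ∀ {n} → PR (suc n) → PR n

data Eval : ∀ {n} → PR n → Vec ℕ n → ℕ → Set
data EvalVec : ∀ {n m} → Vec (PR n) m → Vec ℕ n → Vec ℕ m → Set

data Eval where
  ezer   : ∀ {n} {xs : Vec ℕ n} → Eval zer xs 0
  esucc  : ∀ {x} → Eval succ (x ∷ []) (suc x)
  eproj  : ∀ {n} {i : Fin n} {xs} → Eval (proj i) xs (lookup xs i)
  ecomp  : ∀ {n m} {f : PR m} {gs : Vec (PR n) m} {xs ys y} →
           EvalVec gs xs ys → Eval f ys y → Eval (comp f gs) xs y
  eprec0 : ∀ {n} {g : PR n} {h xs y} → Eval g xs y → Eval (prec g h) (0 ∷ xs) y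
  eprecS : ∀ {n} {g : PR n} {h xs k z y} →
           Eval (prec g h) (k ∷ xs) z → Eval h (k ∷ z ∷ xs) y →
           Eval (prec g h) (suc k ∷ xs) y
  emu    : ∀ {n} {f : PR (suc n)} {xs y} →
           Eval f (y ∷ xs) 0 →
           (∀ z → z < y → Σ ℕ (λ v → Eval f (z ∷ xs) (suc v))) →
           Eval (mu f) xs y

data EvalVec where
  []  : ∀ {n} {xs : Vec ℕ n} → EvalVec [] xs []
  _∷_ : ∀ {n m} {g : PR n} {gs : Vec (PR n) m} {xs y ys} →
        Eval g xs y → EvalVec gs xs ys → EvalVec (g ∷ gs) xs (y ∷ ys)

Total : ∀ {n} → PR n → Set
Total {n} f = (xs : Vec ℕ n) → Σ ℕ (Eval f xs)

enc : ∀ {n} → PR n → ℕ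
encVec : ∀ {n m} → Vec (PR n) m → ℕ
enc zer         = pair 0 0
enc succ        = pair 1 0
enc (proj i)    = pair 2 (toℕ i)
enc (comp f gs) = pair 3 (pair (enc f) (encVec gs))
enc (prec g h)  = pair 4 (pair (enc g) (enc h))
enc (mu f)      = pair 5 (enc f)
encVec []       = 0
encVec (g ∷ gs) = suc (pair (enc g) (encVec gs))

-- The acceptable numbering of r.e. sets: W e = domain of the unary
-- program with code e (empty if e codes no unary program).
W : ℕ → ℕ → Set
W e x = Σ (PR 1) (λ p → enc p ≡ e × Σ ℕ (Eval p (x ∷ [])))

_≐_ : (ℕ → Set) → (ℕ → Set) → Set
A ≐ B = ∀ x → (A x → B x) × (B x → A x)

Le : ℕ → ℕ → ℕ → Set
Le e j x = W e (pair j x)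

-- Length of a sequence indexed by an initial segment of ℕ:
-- just n = {0,…,n-1}, nothing = all of ℕ.
Valid : Maybe ℕ → ℕ → Set
Valid nothing  i = ⊤
Valid (just n) i = i < n

-- The uniformly r.e. sequence of families given by r.e. index w:
-- F_i = { {x : ⟨i,j,x⟩ ∈ W_w} : j ∈ ℕ }.
Fam : ℕ → ℕ → ℕ → ℕ → Set
Fam w i j x = W w (triple i j x)

_⊆ˡ_ : List ℕ → (ℕ → Set) → Set
S ⊆ˡ A = All A S

IsPosTeachSeq : (e w : ℕ) (len : Maybe ℕ) (d : ℕ → ℕ) → Set
IsPosTeachSeq e w len d =
  (∀ i → Valid len i → ∀ j → Σ ℕ (λ k → Fam w i j ≐ Le e k))
  × (∀ k → Σ ℕ (λ i → Valid len i × Σ ℕ (λ j → Le e k ≐ Fam w i j)))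
  × (∀ i i' j j' → Valid len i → Valid len i' →
       Fam w i j ≐ Fam w i' j' → i ≡ i')
  -- (nonemptiness of each F_i is automatic: F_i is indexed by j ∈ ℕ)
  -- teaching condition
  × (∀ i → Valid len i → ∀ j →
       Σ (List ℕ) (λ S →
         Unique S × length S ≡ d i × S ⊆ˡ Fam w i j ×
         (∀ i' j' → Valid len i' → i ≤ i' →
            S ⊆ˡ Fam w i' j' → Fam w i j ≐ Fam w i' j')))

Rure : ℕ → Set
Rure e = Σ ℕ λ w → Σ (Maybe ℕ) λ len → Σ (ℕ → ℕ) λ d →
  IsPosTeachSeq e w len d × Σ ℕ (λ D → ∀ i → Valid len i → d i ≤ D)

_⇔_ : Set → Set → Set
P ⇔ Q = (P → Q) × (Q → P)

Σ⁰₅ : (ℕ → Set) → Set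
Σ⁰₅ A = Σ (PR 6) λ f → Total f ×
  (∀ x → A x ⇔
    Σ ℕ (λ a → ∀ b → Σ ℕ (λ c → ∀ d' → Σ ℕ (λ e →
      Eval f (x ∷ a ∷ b ∷ c ∷ d' ∷ e ∷ []) 0))))

_≤m_ : (ℕ → Set) → (ℕ → Set) → Set
A ≤m B = Σ (PR 1) λ g → Total g ×
  (∀ x y → Eval g (x ∷ []) y → (A x ⇔ B y))

Σ⁰₅-hard : (ℕ → Set) → Set₁
Σ⁰₅-hard B = (A : ℕ → Set) → Σ⁰₅ A → A ≤m B

{-# OPTIONS --safe #-}

-- Write x ∈ A as ∃a ∀b ∃c ∀d ∃u (f = 0).  The Σ₁ relation Progress a B c n, "some a′ ≤ a has
-- for all b ≤ B some c′ ≤ c with ∀d<n ∃u (f = 0)", satisfies by the infinite pigeonhole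
-- principle: if x ∈ A, then for all large a and all B it holds for almost all c and every n;
-- if x ∉ A, then for every a there is a B such that for every c it fails at some n.
--
-- The component (a,B) of the family consists of languages indexed by finite sets σ of labels
-- ⟨c,k′,n⟩.  The element (τ,k,r) of the component lies in the language of σ iff every label on
-- which σ and τ differ is dead (Progress a B c n, or a < k′) or satisfies r < c and k ≠ k′.
-- Languages whose index sets differ only in dead labels coincide.
--  * The a + 1 elements (σ,k,0), k ≤ a, always single out the language of σ; if all labels with
--    large c are dead, then so does one element (σ,0,r) with r large.  So for x ∈ A a single
--    layer of bounded order suffices.
--  * If for every c some ⟨c,k′,n⟩ is not dead, at most a elements of the language of σ miss some
--    k′ ≤ a, and flipping such a label with large c gives another language containing them.  So
--    no language of the component is taught in the first layer that meets the component.
module Submission where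

open import Defs
open import Level using (0ℓ)
open import Axiom.ExcludedMiddle using (ExcludedMiddle)
open import Data.Nat using (ℕ; zero; suc; pred; _+_; _*_; _∸_; _/_; _⊔_; _<_; _≤_; z≤n; s≤s; ⌊_/2⌋)
open import Data.Nat.Properties
open import Data.Nat.DivMod using (+-distrib-/-∣ʳ; m*n/n≡m)
open import Data.Nat.Divisibility using (n∣m*n)
open import Data.Nat.Induction using (<-rec)
open import Data.Nat.Tactic.RingSolver using (solve-∀)
open import Data.Fin using (Fin; suc; toℕ; _↑ʳ_)
open import Data.Fin.Patterns using (0F; 1F; 2F; 3F; 4F; 5F; 6F; 7F; 9F)
open import Data.Fin.Properties using (toℕ<n; toℕ-injective; pigeonhole; ¬∀⟶∃¬)
  renaming (<⇒≢ to <⇒≢ᶠ)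
open import Data.List using (List; []; _∷_; length; upTo)
  renaming (map to mapˡ; lookup to lookupˡ)
open import Data.List.Properties using (length-map; length-upTo)
open import Data.List.Membership.Propositional using (_∈_; _∉_)
open import Data.List.Membership.DecPropositional _≟_ using (_∈?_)
open import Data.List.Membership.Propositional.Properties using (∈-upTo⁺)
open import Data.List.Relation.Unary.Any using (here; there; index)
open import Data.List.Relation.Unary.Any.Properties using (lookup-index)
open import Data.List.Relation.Unary.All using ([]; _∷_; universal)
  renaming (map to mapᵃ; lookup to lookupᵃ)
open import Data.List.Relation.Unary.All.Properties using (map⁺; map⁻)
open import Data.List.Relation.Unary.Unique.Propositional using (Unique)
import Data.List.Relation.Unary.Unique.Propositional.Properties as Unique
open import Data.Maybe using (just)
open import Data.Vec using (Vec; []; _∷_; _++_; map; lookup; allFin)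
open import Data.Vec.Properties using (map-∘; map-cong; map-lookup-allFin; lookup-++ʳ)
open import Data.Product using (Σ; ∃; ∃₂; _×_; _,_; proj₁; proj₂)
open import Data.Sum using (_⊎_; inj₁; inj₂; map₁)
open import Data.Empty using (⊥; ⊥-elim)
open import Function using (_∋_; _∘_)
open import Relation.Binary.Definitions using (tri<; tri≈; tri>)
open import Relation.Binary.PropositionalEquality
  using (_≡_; _≢_; refl; sym; trans; cong; cong₂; subst; module ≡-Reasoning)
open import Relation.Nullary using (¬_; yes; no; contradiction)
open import Relation.Nullary.Decidable using (decidable-stable)

-- Cantor pairing is a bijection.

triangle : ℕ → ℕ
triangle zero    = 0
triangle (suc s) = triangle s + suc s

triangle-formula : ∀ s → (s * suc s) / 2 ≡ triangle s
triangle-formula zero    = refl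
triangle-formula (suc s) = begin
  (suc s * suc (suc s)) / 2        ≡⟨ cong (_/ 2) (expand s) ⟩
  (s * suc s + suc s * 2) / 2      ≡⟨ +-distrib-/-∣ʳ (s * suc s) (n∣m*n (suc s)) ⟩
  (s * suc s) / 2 + suc s * 2 / 2  ≡⟨ cong₂ _+_ (triangle-formula s) (m*n/n≡m (suc s) 2) ⟩
  triangle s + suc s               ∎
  where
  open ≡-Reasoning
  expand : ∀ s → suc s * suc (suc s) ≡ s * suc s + suc s * 2
  expand = solve-∀

pair-formula : ∀ x y → pair x y ≡ triangle (x + y) + y
pair-formula x y = cong (_+ y) (triangle-formula (x + y))

triangle-mono : ∀ {s t} → s ≤ t → triangle s ≤ triangle t
triangle-mono z≤n       = z≤n
triangle-mono (s≤s s≤t) = +-mono-≤ (triangle-mono s≤t) (s≤s s≤t)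

-- Diagonal `s` holds `suc s` codes, with offsets 0 to `s`, so an offset never carries over into
-- diagonal `suc s`. This makes the diagonal of a pair readable from its code.
triangle-gap : ∀ {s t y z} → s < t → y ≤ s → triangle s + y < triangle t + z
triangle-gap {s} {t} {y} {z} s<t y≤s = begin-strict
  triangle s + y      <⟨ +-monoʳ-< (triangle s) (s≤s y≤s) ⟩
  triangle (suc s)    ≤⟨ triangle-mono s<t ⟩
  triangle t          ≤⟨ m≤m+n (triangle t) z ⟩
  triangle t + z      ∎
  where open ≤-Reasoning

pair-injective : ∀ x x′ {y y′} → pair x y ≡ pair x′ y′ → x ≡ x′ × y ≡ y′
pair-injective x x′ {y} {y′} eq with <-cmp (x + y) (x′ + y′)
... | tri< lt _ _ = contradiction eq′ (<⇒≢ (triangle-gap lt (m≤n+m y x)))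
  where eq′ = trans (sym (pair-formula x y)) (trans eq (pair-formula x′ y′))
... | tri> _ _ gt = contradiction (sym eq′) (<⇒≢ (triangle-gap gt (m≤n+m y′ x′)))
  where eq′ = trans (sym (pair-formula x y)) (trans eq (pair-formula x′ y′))
... | tri≈ _ s≡ _ = x≡ , y≡
  where
  eq′ : triangle (x + y) + y ≡ triangle (x + y) + y′
  eq′ = trans (sym (pair-formula x y)) (trans eq
          (trans (pair-formula x′ y′) (cong (λ s → triangle s + y′) (sym s≡))))
  y≡ : y ≡ y′
  y≡ = +-cancelˡ-≡ (triangle (x + y)) y y′ eq′
  x≡ : x ≡ x′
  x≡ = +-cancelʳ-≡ y x x′ (trans s≡ (cong (x′ +_) (sym y≡)))

triple-injective : ∀ x x′ y y′ {z z′} → triple x y z ≡ triple x′ y′ z′ →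
                   x ≡ x′ × y ≡ y′ × z ≡ z′
triple-injective x x′ y y′ eq with pair-injective x x′ eq
... | x≡ , eq′ = x≡ , pair-injective y y′ eq′

-- Induction along the diagonals: after `(suc x , y)` comes `(x , suc y)`, and after the end
-- `(0 , y)` of a diagonal comes the start `(suc y , 0)` of the next.
pair-surjective : ∀ z → ∃₂ λ x y → z ≡ pair x y
pair-surjective zero = 0 , 0 , refl
pair-surjective (suc z) with pair-surjective z
... | zero , y , refl = suc y , 0 , (begin
  suc (pair 0 y)                     ≡⟨ cong suc (pair-formula 0 y) ⟩
  suc (triangle y + y)               ≡⟨ sym (+-suc (triangle y) y) ⟩
  triangle (suc y)                   ≡⟨ cong triangle (sym (+-identityʳ (suc y))) ⟩
  triangle (suc y + 0)               ≡⟨ sym (+-identityʳ _) ⟩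
  triangle (suc y + 0) + 0           ≡⟨ sym (pair-formula (suc y) 0) ⟩
  pair (suc y) 0                     ∎)
  where open ≡-Reasoning
... | suc x , y , refl = x , suc y , (begin
  suc (pair (suc x) y)               ≡⟨ cong suc (pair-formula (suc x) y) ⟩
  suc (triangle (suc x + y) + y)     ≡⟨ sym (+-suc _ y) ⟩
  triangle (suc x + y) + suc y       ≡⟨ cong (λ s → triangle s + suc y) (sym (+-suc x y)) ⟩
  triangle (x + suc y) + suc y       ≡⟨ sym (pair-formula x (suc y)) ⟩
  pair x (suc y)                     ∎)
  where open ≡-Reasoning

triple-surjective : ∀ w → Σ ℕ λ x → ∃₂ λ y z → w ≡ triple x y z
triple-surjective w with pair-surjective w
... | x , v , refl with pair-surjective v
... | y , z , refl = x , y , z , refl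

-- Injectivity of the coding of programs.

tag body : ∀ {n} → PR n → ℕ
tag zer          = 0
tag succ         = 1
tag (proj _)     = 2
tag (comp _ _)   = 3
tag (prec _ _)   = 4
tag (mu _)       = 5
body zer         = 0
body succ        = 0
body (proj i)    = toℕ i
body (comp f gs) = pair (enc f) (encVec gs)
body (prec g h)  = pair (enc g) (enc h)
body (mu f)      = enc f

enc-tag-body : ∀ {n} (p : PR n) → enc p ≡ pair (tag p) (body p)
enc-tag-body zer        = refl
enc-tag-body succ       = refl
enc-tag-body (proj _)   = refl
enc-tag-body (comp _ _) = refl
enc-tag-body (prec _ _) = refl
enc-tag-body (mu _)     = refl

same-tag-body : ∀ {n} (p q : PR n) → enc p ≡ enc q → tag p ≡ tag q × body p ≡ body q
same-tag-body p q eq =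
  pair-injective (tag p) (tag q) (trans (sym (enc-tag-body p)) (trans eq (enc-tag-body q)))

enc-injective : ∀ {n} (p q : PR n) → enc p ≡ enc q → p ≡ q
-- With the tag equation as a separate argument, matching it on `refl` leaves only the cases with
-- equal constructors.
tag-body-injective : ∀ {n} (p q : PR n) → tag p ≡ tag q → body p ≡ body q → p ≡ q
-- The length of the vector is read off its code.
encVec-injective : ∀ {n m m′} (ps : Vec (PR n) m) (qs : Vec (PR n) m′) →
  encVec ps ≡ encVec qs → (m , ps) ≡ (Σ ℕ (Vec (PR n)) ∋ (m′ , qs))

enc-injective p q eq with same-tag-body p q eq
... | t≡ , b≡ = tag-body-injective p q t≡ b≡

tag-body-injective zer        zer          refl _ = refl
tag-body-injective succ       succ         refl _ = refl
tag-body-injective (proj i)   (proj j)     refl b = cong proj (toℕ-injective b)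
tag-body-injective (comp f gs) (comp f′ gs′) refl b with pair-injective (enc f) (enc f′) b
... | f≡ , gs≡ with encVec-injective gs gs′ gs≡
...   | refl = cong (λ h → comp h gs) (enc-injective f f′ f≡)
tag-body-injective (prec g h) (prec g′ h′) refl b with pair-injective (enc g) (enc g′) b
... | g≡ , h≡ = cong₂ prec (enc-injective g g′ g≡) (enc-injective h h′ h≡)
tag-body-injective (mu f)     (mu f′)      refl b = cong mu (enc-injective f f′ b)

encVec-injective []       []       _  = refl
encVec-injective (p ∷ ps) (q ∷ qs) eq with pair-injective (enc p) (enc q) (suc-injective eq)
... | p≡ , ps≡ with enc-injective p q p≡ | encVec-injective ps qs ps≡
...   | refl | refl = refl

-- Evaluation is single-valued.

Eval-deterministic : ∀ {n} (p : PR n) {xs y z} → Eval p xs y → Eval p xs z → y ≡ z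
EvalVec-deterministic : ∀ {n m} (ps : Vec (PR n) m) {xs ys zs} →
  EvalVec ps xs ys → EvalVec ps xs zs → ys ≡ zs

Eval-deterministic zer  ezer  ezer  = refl
Eval-deterministic succ esucc esucc = refl
Eval-deterministic (proj i) eproj eproj = refl
Eval-deterministic (comp f gs) (ecomp as b) (ecomp as′ b′)
  with refl ← EvalVec-deterministic gs as as′ = Eval-deterministic f b b′
Eval-deterministic (prec g h) (eprec0 a) (eprec0 a′) = Eval-deterministic g a a′
Eval-deterministic (prec g h) (eprecS a b) (eprecS a′ b′)
  with refl ← Eval-deterministic (prec g h) a a′ = Eval-deterministic h b b′
Eval-deterministic (mu f) {y = y} {z} (emu zero-y below-y) (emu zero-z below-z)
  with <-cmp y z
... | tri≈ _ y≡z _ = y≡z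
-- At the smaller of the two results `f` would take both the value 0 and a successor.
... | tri< y<z _ _ =
  contradiction (Eval-deterministic f zero-y (proj₂ (below-z y y<z))) 0≢1+n
... | tri> _ _ z<y =
  contradiction (Eval-deterministic f zero-z (proj₂ (below-y z z<y))) 0≢1+n

EvalVec-deterministic []       []       []         = refl
EvalVec-deterministic (p ∷ ps) (a ∷ as) (a′ ∷ as′) =
  cong₂ _∷_ (Eval-deterministic p a a′) (EvalVec-deterministic ps as as′)

-- Total recursive functions with certified programs.

record Fun (n : ℕ) : Set where
  field
    prog    : PR n
    val     : Vec ℕ n → ℕ
    correct : ∀ xs → Eval prog xs (val xs)
open Fun

vals : ∀ {n m} → Vec (Fun n) m → Vec ℕ n → Vec ℕ m
vals Gs xs = map (λ G → val G xs) Gs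

progs-correct : ∀ {n m} (Gs : Vec (Fun n) m) xs → EvalVec (map prog Gs) xs (vals Gs xs)
progs-correct []       xs = []
progs-correct (G ∷ Gs) xs = correct G xs ∷ progs-correct Gs xs

infixr 9 _∙_
_∙_ : ∀ {n m} → Fun m → Vec (Fun n) m → Fun n
(F ∙ Gs) .prog       = comp (prog F) (map prog Gs)
(F ∙ Gs) .val xs     = val F (vals Gs xs)
(F ∙ Gs) .correct xs = ecomp (progs-correct Gs xs) (correct F (vals Gs xs))

-- Keeps the program and swaps the raw recursor semantics for the intended arithmetic function, so
-- that meanings of formulas unfold to ordinary statements about numbers.
_withVal_by_ : ∀ {n} (F : Fun n) (v : Vec ℕ n → ℕ) → (∀ xs → val F xs ≡ v xs) → Fun n
(F withVal v by eq) .prog       = prog F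
(F withVal v by eq) .val        = v
(F withVal v by eq) .correct xs = subst (Eval (prog F) xs) (eq xs) (correct F xs)

var : ∀ {n} → Fin n → Fun n
var i .prog       = proj i
var i .val xs     = lookup xs i
var i .correct xs = eproj

sucF : Fun 1
sucF .prog             = succ
sucF .val (x ∷ [])     = suc x
sucF .correct (x ∷ []) = esucc

numeral : ∀ {n} → ℕ → PR n
numeral zero    = zer
numeral (suc c) = comp succ (numeral c ∷ [])

numeral-correct : ∀ {n} c (xs : Vec ℕ n) → Eval (numeral c) xs c
numeral-correct zero    xs = ezer
numeral-correct (suc c) xs = ecomp (numeral-correct c xs ∷ []) esucc

const : ∀ {n} → ℕ → Fun n
const c .prog       = numeral c
const c .val _      = c
const c .correct xs = numeral-correct c xs

primrec : ∀ {n} → Fun n → Fun (suc (suc n)) → Fun (suc n)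
primrec {n} G H = record { prog = prec (prog G) (prog H) ; val = v ; correct = c }
  where
  v : Vec ℕ (suc n) → ℕ
  v (zero ∷ xs)  = val G xs
  v (suc k ∷ xs) = val H (k ∷ v (k ∷ xs) ∷ xs)
  c : ∀ xs → Eval (prec (prog G) (prog H)) xs (v xs)
  c (zero ∷ xs)  = eprec0 (correct G xs)
  c (suc k ∷ xs) = eprecS (c (k ∷ xs)) (correct H _)

suffix : ∀ m {n} → Vec (Fun (m + n)) n
suffix m {n} = map (λ i → var (m ↑ʳ i)) (allFin n)

suffix-correct : ∀ {m n} (ys : Vec ℕ m) (xs : Vec ℕ n) →
  EvalVec (map prog (suffix m)) (ys ++ xs) xs
suffix-correct {m} {n} ys xs =
  subst (EvalVec _ (ys ++ xs)) vals≡ (progs-correct (suffix m) (ys ++ xs))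
  where
  open ≡-Reasoning
  vals≡ : vals (suffix m) (ys ++ xs) ≡ xs
  vals≡ = begin
    vals (suffix m) (ys ++ xs)                         ≡⟨ sym (map-∘ _ _ (allFin n)) ⟩
    map (λ i → lookup (ys ++ xs) (m ↑ʳ i)) (allFin n)  ≡⟨ map-cong (lookup-++ʳ ys xs) (allFin n) ⟩
    map (lookup xs) (allFin n)                         ≡⟨ map-lookup-allFin xs ⟩
    xs                                                 ∎

weaken : ∀ {n} → Fun n → Fun (suc n)
weaken F .prog             = comp (prog F) (map prog (suffix 1))
weaken F .val (_ ∷ xs)     = val F xs
weaken F .correct (t ∷ xs) = ecomp (suffix-correct (t ∷ []) xs) (correct F xs)

addF : Fun 2
addF = primrec (var 0F) (sucF ∙ (var 1F ∷ [])) withVal (λ { (x ∷ y ∷ []) → x + y })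
       by λ { (x ∷ y ∷ []) → eq x y }
  where
  eq : ∀ x y → val (primrec (var 0F) (sucF ∙ (var 1F ∷ []))) (x ∷ y ∷ []) ≡ x + y
  eq zero    y = refl
  eq (suc x) y = cong suc (eq x y)

mulF : Fun 2
mulF = primrec (const 0) (addF ∙ (var 2F ∷ var 1F ∷ [])) withVal (λ { (x ∷ y ∷ []) → x * y })
       by λ { (x ∷ y ∷ []) → eq x y }
  where
  eq : ∀ x y → val (primrec (const 0) (addF ∙ (var 2F ∷ var 1F ∷ []))) (x ∷ y ∷ []) ≡ x * y
  eq zero    y = refl
  eq (suc x) y = cong (y +_) (eq x y)

predF : Fun 1
predF = primrec (const 0) (var 0F) withVal (λ { (x ∷ []) → pred x })
        by λ { (zero ∷ []) → refl ; (suc x ∷ []) → refl }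

monusF : Fun 2
-- Recursion runs on the first argument, so the arguments are swapped to recurse on the subtrahend.
monusF = (primrec (var 0F) (predF ∙ (var 1F ∷ [])) ∙ (var 1F ∷ var 0F ∷ []))
         withVal (λ { (x ∷ y ∷ []) → x ∸ y }) by λ { (x ∷ y ∷ []) → eq x y }
  where
  eq : ∀ x y → val (primrec (var 0F) (predF ∙ (var 1F ∷ []))) (y ∷ x ∷ []) ≡ x ∸ y
  eq x zero    = refl
  eq x (suc y) = trans (cong pred (eq x y)) (pred[m∸n]≡m∸[1+n] x y)

triangleF : Fun 1
triangleF = primrec (const 0) (addF ∙ (var 1F ∷ sucF ∙ (var 0F ∷ []) ∷ []))
            withVal (λ { (s ∷ []) → triangle s }) by λ { (s ∷ []) → eq s }
  where
  eq : ∀ s → val (primrec (const 0) (addF ∙ (var 1F ∷ sucF ∙ (var 0F ∷ []) ∷ []))) (s ∷ []) ≡ triangle s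
  eq zero    = refl
  eq (suc s) = cong (_+ suc s) (eq s)

pairF : Fun 2
pairF = (addF ∙ (triangleF ∙ (addF ∙ (var 0F ∷ var 1F ∷ []) ∷ []) ∷ var 1F ∷ []))
        withVal (λ { (x ∷ y ∷ []) → pair x y }) by λ { (x ∷ y ∷ []) → sym (pair-formula x y) }

parity : ℕ → ℕ
parity zero    = 0
parity (suc n) = 1 ∸ parity n

parityF : Fun 1
parityF = primrec (const 0) (monusF ∙ (const 1 ∷ var 1F ∷ []))
          withVal (λ { (n ∷ []) → parity n }) by λ { (n ∷ []) → eq n }
  where
  eq : ∀ n → val (primrec (const 0) (monusF ∙ (const 1 ∷ var 1F ∷ []))) (n ∷ []) ≡ parity n
  eq zero    = refl
  eq (suc n) = cong (1 ∸_) (eq n)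

data Bit : ℕ → Set where
  0ᵇ : Bit 0
  1ᵇ : Bit 1

parity-bit : ∀ n → Bit (parity n)
parity-bit zero = 0ᵇ
parity-bit (suc n) with parity n | parity-bit n
... | _ | 0ᵇ = 1ᵇ
... | _ | 1ᵇ = 0ᵇ

half-suc : ∀ n → parity n + ⌊ n /2⌋ ≡ ⌊ suc n /2⌋
half-suc zero          = refl
half-suc (suc zero)    = refl
half-suc (suc (suc n)) with parity n | parity-bit n | half-suc n
... | _ | 0ᵇ | eq = cong suc eq
... | _ | 1ᵇ | eq = cong suc eq

halfF : Fun 1
halfF = primrec (const 0) (addF ∙ (parityF ∙ (var 0F ∷ []) ∷ var 1F ∷ []))
        withVal (λ { (n ∷ []) → ⌊ n /2⌋ }) by λ { (n ∷ []) → eq n }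
  where
  eq : ∀ n → val (primrec (const 0) (addF ∙ (parityF ∙ (var 0F ∷ []) ∷ var 1F ∷ []))) (n ∷ []) ≡ ⌊ n /2⌋
  eq zero    = refl
  eq (suc n) = trans (cong (parity n +_) (eq n)) (half-suc n)

bit : ℕ → ℕ → ℕ
bit zero    s = parity s
bit (suc m) s = bit m ⌊ s /2⌋

bitF : Fun 2
bitF = (parityF ∙ (shift ∷ [])) withVal (λ { (m ∷ s ∷ []) → bit m s })
       by λ { (m ∷ s ∷ []) → eq m s }
  where
  shift : Fun 2
  shift = primrec (var 0F) (halfF ∙ (var 1F ∷ []))
  -- `shift` halves after recursing and `bit` halves before; this exchanges the two orders.
  shift-half : ∀ m s → val shift (suc m ∷ s ∷ []) ≡ val shift (m ∷ ⌊ s /2⌋ ∷ [])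
  shift-half zero    s = refl
  shift-half (suc m) s = cong ⌊_/2⌋ (shift-half m s)
  eq : ∀ m s → parity (val shift (m ∷ s ∷ [])) ≡ bit m s
  eq zero    s = refl
  eq (suc m) s = trans (cong parity (shift-half m s)) (eq m ⌊ s /2⌋)

-- From (t, y, ρ) ↦ χ to (k, t, ρ) ↦ the fold of χ over y < k: the stage t stays fixed.
foldBelow : ∀ {n} → Fun 2 → ℕ → Fun (suc (suc n)) → Fun (suc (suc n))
foldBelow {n} op base χ = primrec (const base) (op ∙ (var 1F ∷ step ∷ []))
  where
  step : Fun (suc (suc (suc n)))
  step .prog                        = comp (prog χ) (proj 2F ∷ proj 0F ∷ map prog (suffix 3))
  step .val (y ∷ _ ∷ t ∷ ρ)         = val χ (t ∷ y ∷ ρ)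
  step .correct (y ∷ z ∷ t ∷ ρ)     =
    ecomp (eproj ∷ eproj ∷ suffix-correct (y ∷ z ∷ t ∷ []) ρ) (correct χ _)

-- Existential formulas with bounded universal quantifiers, and their semidecision.

infix  7 _≈_ _≺_
infixr 6 _∧_
infixr 5 _∨_

-- There is no negation and universal quantifiers are bounded, so truth is semidecidable.
-- Substitution is a constructor so that formulas can be reused without renaming variables.
data Formula (n : ℕ) : Set where
  _≈_ _≺_ : Fun n → Fun n → Formula n
  _∧_ _∨_ : Formula n → Formula n → Formula n
  exists  : Formula (suc n) → Formula n
  forall< : Fun n → Formula (suc n) → Formula n
  _[_]    : ∀ {m} → Formula m → Vec (Fun n) m → Formula n

⟦_⟧ : ∀ {n} → Formula n → Vec ℕ n → Set
⟦ F ≈ G ⟧       ρ = val F ρ ≡ val G ρ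
⟦ F ≺ G ⟧       ρ = val F ρ < val G ρ
⟦ φ ∧ ψ ⟧       ρ = ⟦ φ ⟧ ρ × ⟦ ψ ⟧ ρ
⟦ φ ∨ ψ ⟧       ρ = ⟦ φ ⟧ ρ ⊎ ⟦ ψ ⟧ ρ
⟦ exists φ ⟧    ρ = ∃ λ y → ⟦ φ ⟧ (y ∷ ρ)
⟦ forall< F φ ⟧ ρ = ∀ y → y < val F ρ → ⟦ φ ⟧ (y ∷ ρ)
⟦ φ [ Gs ] ⟧    ρ = ⟦ φ ⟧ (vals Gs ρ)

-- The first argument is a stage t: the test vanishes iff φ can be verified with all
-- existential witnesses below t, which is monotone in t.
test : ∀ {n} → Formula n → Fun (suc n)
test (F ≈ G)       = weaken (addF ∙ (monusF ∙ (F ∷ G ∷ []) ∷ monusF ∙ (G ∷ F ∷ []) ∷ []))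
test (F ≺ G)       = weaken (monusF ∙ (sucF ∙ (F ∷ []) ∷ G ∷ []))
test (φ ∧ ψ)       = addF ∙ (test φ ∷ test ψ ∷ [])
test (φ ∨ ψ)       = mulF ∙ (test φ ∷ test ψ ∷ [])
test (exists φ)    = record
  { prog    = comp (prog all) (proj 0F ∷ proj 0F ∷ map prog (suffix 1))
  ; val     = λ { (t ∷ ρ) → val all (t ∷ t ∷ ρ) }
  ; correct = λ { (t ∷ ρ) → ecomp (eproj ∷ eproj ∷ suffix-correct (t ∷ []) ρ) (correct all _) }
  }
  where all = foldBelow mulF 1 (test φ)
test (forall< F φ) = record
  { prog    = comp (prog all) (prog (weaken F) ∷ proj 0F ∷ map prog (suffix 1))
  ; val     = λ { (t ∷ ρ) → val all (val F ρ ∷ t ∷ ρ) }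
  ; correct = λ { (t ∷ ρ) → ecomp (correct (weaken F) (t ∷ ρ) ∷ eproj ∷ suffix-correct (t ∷ []) ρ)
                                  (correct all _) }
  }
  where all = foldBelow addF 0 (test φ)
test (φ [ Gs ])    = record
  { prog    = comp (prog (test φ)) (proj 0F ∷ map prog (map weaken Gs))
  ; val     = λ { (t ∷ ρ) → val (test φ) (t ∷ vals Gs ρ) }
  ; correct = λ { (t ∷ ρ) → ecomp (eproj ∷ weakened Gs t ρ) (correct (test φ) _) }
  }
  where
  weakened : ∀ {n m} (Gs : Vec (Fun n) m) t ρ →
             EvalVec (map prog (map weaken Gs)) (t ∷ ρ) (vals Gs ρ)
  weakened []       t ρ = []
  weakened (G ∷ Gs) t ρ = correct (weaken G) (t ∷ ρ) ∷ weakened Gs t ρ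

Passes : ∀ {n} → Formula n → ℕ → Vec ℕ n → Set
Passes φ t ρ = val (test φ) (t ∷ ρ) ≡ 0

module _ {n} (χ : Fun (suc (suc n))) (t : ℕ) (ρ : Vec ℕ n) where

  private
    Vanishes : ℕ → Set
    Vanishes y = val χ (t ∷ y ∷ ρ) ≡ 0

  product-vanishes : ∀ {k y} → y < k → Vanishes y → val (foldBelow mulF 1 χ) (k ∷ t ∷ ρ) ≡ 0
  product-vanishes {suc k} {y} y<1+k v with m≤n⇒m<n∨m≡n (≤-pred y<1+k)
  ... | inj₁ y<k  = cong (_* val χ (t ∷ k ∷ ρ)) (product-vanishes y<k v)
  ... | inj₂ refl = trans (cong (val (foldBelow mulF 1 χ) (y ∷ t ∷ ρ) *_) v)
                          (*-zeroʳ (val (foldBelow mulF 1 χ) (y ∷ t ∷ ρ)))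

  vanishing-factor : ∀ k → val (foldBelow mulF 1 χ) (k ∷ t ∷ ρ) ≡ 0 → ∃ λ y → y < k × Vanishes y
  vanishing-factor (suc k) eq
    with m*n≡0⇒m≡0∨n≡0 (val (foldBelow mulF 1 χ) (k ∷ t ∷ ρ)) eq
  ... | inj₂ v  = k , ≤-refl , v
  ... | inj₁ v with vanishing-factor k v
  ...   | y , y<k , w = y , m≤n⇒m≤1+n y<k , w

  sum-vanishes : ∀ k → (∀ y → y < k → Vanishes y) → val (foldBelow addF 0 χ) (k ∷ t ∷ ρ) ≡ 0
  sum-vanishes zero    h = refl
  sum-vanishes (suc k) h =
    cong₂ _+_ (sum-vanishes k (λ y y<k → h y (m≤n⇒m≤1+n y<k))) (h k ≤-refl)

  vanishing-summand : ∀ k → val (foldBelow addF 0 χ) (k ∷ t ∷ ρ) ≡ 0 → ∀ y → y < k → Vanishes y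
  vanishing-summand (suc k) eq y y<1+k with m≤n⇒m<n∨m≡n (≤-pred y<1+k)
  ... | inj₁ y<k  = vanishing-summand k (m+n≡0⇒m≡0 _ eq) y y<k
  ... | inj₂ refl = m+n≡0⇒n≡0 (val (foldBelow addF 0 χ) (y ∷ t ∷ ρ)) eq

-- Conjunction and `forall<` are tested by sums, whose ranges do not depend on the stage;
-- disjunction and `exists` are tested by products, and a larger stage only adds factors to the
-- latter.
passes-mono : ∀ {n} (φ : Formula n) {t u ρ} → t ≤ u → Passes φ t ρ → Passes φ u ρ
passes-mono (F ≈ G)    t≤u p = p
passes-mono (F ≺ G)    t≤u p = p
passes-mono (φ ∧ ψ) {t} {u} {ρ} t≤u p =
  cong₂ _+_ (passes-mono φ t≤u (m+n≡0⇒m≡0 _ p))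
            (passes-mono ψ t≤u (m+n≡0⇒n≡0 (val (test φ) (t ∷ ρ)) p))
passes-mono (φ ∨ ψ) {t} {u} {ρ} t≤u p with m*n≡0⇒m≡0∨n≡0 (val (test φ) (t ∷ ρ)) p
... | inj₁ q = cong (_* val (test ψ) (u ∷ ρ)) (passes-mono φ t≤u q)
... | inj₂ q = trans (cong (val (test φ) (u ∷ ρ) *_) (passes-mono ψ t≤u q))
                     (*-zeroʳ (val (test φ) (u ∷ ρ)))
passes-mono (exists φ) {t} {u} {ρ} t≤u p with vanishing-factor (test φ) t ρ t p
... | y , y<t , q = product-vanishes (test φ) u ρ (≤-trans y<t t≤u) (passes-mono φ t≤u q)
passes-mono (forall< F φ) {t} {u} {ρ} t≤u p =
  sum-vanishes (test φ) u ρ (val F ρ) λ y y< →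
    passes-mono φ t≤u (vanishing-summand (test φ) t ρ (val F ρ) p y y<)
passes-mono (φ [ Gs ]) t≤u p = passes-mono φ t≤u p

upper-bound : (u : ∀ (i : ℕ) → ℕ) → ∀ k → ∃ λ m → ∀ i → i < k → u i ≤ m
upper-bound u zero    = 0 , λ _ ()
upper-bound u (suc k) with upper-bound u k
... | m , h = m + u k , λ i i<1+k → case (m≤n⇒m<n∨m≡n (≤-pred i<1+k))
  where
  case : ∀ {i} → i < k ⊎ i ≡ k → u i ≤ m + u k
  case (inj₁ i<k)  = ≤-trans (h _ i<k) (m≤m+n m (u k))
  case (inj₂ refl) = m≤n+m (u k) m

passes-sound : ∀ {n} (φ : Formula n) {t ρ} → Passes φ t ρ → ⟦ φ ⟧ ρ
passes-sound (F ≈ G) {ρ = ρ} p =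
  ≤-antisym (m∸n≡0⇒m≤n (m+n≡0⇒m≡0 _ p))
            (m∸n≡0⇒m≤n (m+n≡0⇒n≡0 (val F ρ ∸ val G ρ) p))
passes-sound (F ≺ G)     p = m∸n≡0⇒m≤n p
passes-sound (φ ∧ ψ) {t} {ρ} p =
  passes-sound φ (m+n≡0⇒m≡0 _ p) , passes-sound ψ (m+n≡0⇒n≡0 (val (test φ) (t ∷ ρ)) p)
passes-sound (φ ∨ ψ) {t} {ρ} p with m*n≡0⇒m≡0∨n≡0 (val (test φ) (t ∷ ρ)) p
... | inj₁ q = inj₁ (passes-sound φ q)
... | inj₂ q = inj₂ (passes-sound ψ q)
passes-sound (exists φ) {t} {ρ} p with vanishing-factor (test φ) t ρ t p
... | y , _ , q = y , passes-sound φ q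
passes-sound (forall< F φ) {t} {ρ} p y y< =
  passes-sound φ (vanishing-summand (test φ) t ρ (val F ρ) p y y<)
passes-sound (φ [ Gs ]) p = passes-sound φ p

-- Subformulas may pass at different stages; by `passes-mono` a sum of finitely many stages serves
-- them all.
passes-complete : ∀ {n} (φ : Formula n) {ρ} → ⟦ φ ⟧ ρ → ∃ λ t → Passes φ t ρ
passes-complete (F ≈ G) {ρ} h = 0 ,
  cong₂ _+_ (m≤n⇒m∸n≡0 (≤-reflexive h)) (m≤n⇒m∸n≡0 (≤-reflexive (sym h)))
passes-complete (F ≺ G) h = 0 , m≤n⇒m∸n≡0 h
passes-complete (φ ∧ ψ) (h , k) with passes-complete φ h | passes-complete ψ k
... | t , p | u , q =
  t + u , cong₂ _+_ (passes-mono φ (m≤m+n t u) p) (passes-mono ψ (m≤n+m u t) q)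
passes-complete (φ ∨ ψ) {ρ} (inj₁ h) with passes-complete φ h
... | t , p = t , cong (_* val (test ψ) (t ∷ ρ)) p
passes-complete (φ ∨ ψ) {ρ} (inj₂ h) with passes-complete ψ h
... | t , p = t , trans (cong (val (test φ) (t ∷ ρ) *_) p) (*-zeroʳ (val (test φ) (t ∷ ρ)))
passes-complete (exists φ) {ρ} (y , h) with passes-complete φ h
-- The stage must exceed the witness `y`, since `exists` searches only below it.
... | t , p = suc y + t , product-vanishes (test φ) (suc y + t) ρ (m≤m+n (suc y) t)
                            (passes-mono φ (m≤n+m t (suc y)) p)
passes-complete (forall< F φ) {ρ} h = T , sum-vanishes (test φ) T ρ (val F ρ) passes
  where
  stage : ∀ k → (∀ y → y < k → ∃ λ t → Passes φ t (y ∷ ρ)) →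
          ∃ λ t → ∀ y → y < k → Passes φ t (y ∷ ρ)
  stage zero    _ = 0 , λ _ ()
  stage (suc k) s with stage k (λ y y<k → s y (m≤n⇒m≤1+n y<k)) | s k ≤-refl
  ... | t , p | u , q = t + u , λ y y<1+k → pick (m≤n⇒m<n∨m≡n (≤-pred y<1+k))
    where
    pick : ∀ {y} → y < k ⊎ y ≡ k → Passes φ (t + u) (y ∷ ρ)
    pick (inj₁ y<k)  = passes-mono φ (m≤m+n t u) (p _ y<k)
    pick (inj₂ refl) = passes-mono φ (m≤n+m u t) q
  staged = stage (val F ρ) (λ y y< → passes-complete φ (h y y<))
  T      = proj₁ staged
  passes = proj₂ staged
passes-complete (φ [ Gs ]) h = passes-complete φ h

-- The rule `emu` demands successor values at all smaller arguments, so a stage that passes must be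
-- traded for the first one.
least-zero : (u : ℕ → ℕ) → ∀ t → u t ≡ 0 →
             ∃ λ y → u y ≡ 0 × (∀ z → z < y → ∃ λ v → u z ≡ suc v)
least-zero u t ut≡0 with search t
  where
  search : ∀ k → (∃ λ y → u y ≡ 0 × (∀ z → z < y → ∃ λ v → u z ≡ suc v)) ⊎
               (∀ z → z < k → ∃ λ v → u z ≡ suc v)
  search zero = inj₂ λ _ ()
  search (suc k) with search k
  ... | inj₁ found = inj₁ found
  ... | inj₂ none with u k in uk≡
  ...   | zero  = inj₁ (k , uk≡ , none)
  ...   | suc v = inj₂ λ z z<1+k → pick (m≤n⇒m<n∨m≡n (≤-pred z<1+k))
    where
    pick : ∀ {z} → z < k ⊎ z ≡ k → ∃ λ v → u z ≡ suc v
    pick (inj₁ z<k)  = none _ z<k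
    pick (inj₂ refl) = v , uk≡
... | inj₁ found = found
... | inj₂ none  = t , ut≡0 , none

semidecide : ∀ {n} → Formula n → PR n
semidecide φ = mu (prog (test φ))

semidecide-sound : ∀ {n} (φ : Formula n) {ρ v} → Eval (semidecide φ) ρ v → ⟦ φ ⟧ ρ
semidecide-sound φ (emu e _) =
  passes-sound φ (Eval-deterministic (prog (test φ)) (correct (test φ) _) e)

semidecide-complete : ∀ {n} (φ : Formula n) {ρ} → ⟦ φ ⟧ ρ → ∃ λ v → Eval (semidecide φ) ρ v
semidecide-complete φ {ρ} h with passes-complete φ h
... | t , p with least-zero (λ s → val (test φ) (s ∷ ρ)) t p
...   | y , zero-y , below = y , emu (evalsTo y zero-y) λ z z<y →
          proj₁ (below z z<y) , evalsTo z (proj₂ (below z z<y))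
  where
  evalsTo : ∀ s {v} → val (test φ) (s ∷ ρ) ≡ v → Eval (prog (test φ)) (s ∷ ρ) v
  evalsTo s refl = correct (test φ) (s ∷ ρ)

-- The s-m-n theorem for `W`.

specialise : PR 2 → ℕ → PR 1
specialise P x = comp P (numeral x ∷ proj 0F ∷ [])

-- `W` quantifies over all programs with the given code; injectivity of `enc` leaves only the
-- specialised one.
W-specialise : ∀ P x y → W (enc (specialise P x)) y ⇔ ∃ (Eval P (x ∷ y ∷ []))
W-specialise P x y = to , from
  where
  to : W (enc (specialise P x)) y → ∃ (Eval P (x ∷ y ∷ []))
  to (p , eq , v , e) with refl ← enc-injective p (specialise P x) eq
    with e
  ... | ecomp (a ∷ eproj ∷ []) b
    with refl ← Eval-deterministic (numeral x) a (numeral-correct x _) = v , b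
  from : ∃ (Eval P (x ∷ y ∷ [])) → W (enc (specialise P x)) y
  from (v , e) = specialise P x , refl , v , ecomp (numeral-correct x _ ∷ eproj ∷ []) e

-- Only the numeral inside `specialise P x` depends on `x`, so computing its code by primitive
-- recursion makes the whole index computable.
numeralCodeF : Fun 1
numeralCodeF = primrec (const (enc {0} zer)) codeSuc withVal (λ { (x ∷ []) → enc (numeral {1} x) })
               by λ { (x ∷ []) → eq x }
  where
  codeSuc : Fun 2
  codeSuc = pairF ∙ (const 3 ∷ pairF ∙ (const (enc succ) ∷
              sucF ∙ (pairF ∙ (var 1F ∷ const 0 ∷ []) ∷ []) ∷ []) ∷ [])
  eq : ∀ x → val (primrec (const (enc {0} zer)) codeSuc) (x ∷ []) ≡ enc (numeral {1} x)
  eq zero    = refl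
  eq (suc x) = cong (λ c → pair 3 (pair (enc succ) (suc (pair c 0)))) (eq x)

specialiseCodeF : PR 2 → Fun 1
specialiseCodeF P =
  (pairF ∙ (const 3 ∷ pairF ∙ (const (enc P) ∷
    sucF ∙ (pairF ∙ (numeralCodeF ∷ const (encVec (Vec (PR 1) 1 ∋ proj 0F ∷ [])) ∷ []) ∷ []) ∷ []) ∷ []))
  withVal (λ { (x ∷ []) → enc (specialise P x) })
  by λ { (x ∷ []) → refl }

-- Equality of languages, and an obstruction to teaching sequences.

≐-sym : ∀ {A B} → A ≐ B → B ≐ A
≐-sym eq x = proj₂ (eq x) , proj₁ (eq x)

≐-trans : ∀ {A B C} → A ≐ B → B ≐ C → A ≐ C
≐-trans p q x = proj₁ (q x) ∘ proj₁ (p x) , proj₂ (p x) ∘ proj₂ (q x)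

module _ (a : ℕ) (F : ℕ → ℕ → ℕ → Set) (V : ℕ → Set) (d : ℕ → ℕ)
  (order : ∀ i → V i → d i ≤ a)
  (teachable : ∀ i → V i → ∀ j → ∃ λ S → Unique S × length S ≡ d i × S ⊆ˡ F i j ×
     (∀ i′ j′ → V i′ → i ≤ i′ → S ⊆ˡ F i′ j′ → F i j ≐ F i′ j′))
  (L : ℕ → ℕ → Set)
  (covers : ∀ σ → ∃ λ i → V i × ∃ λ j → F i j ≐ L σ)
  (not-taught : ∀ {σ S} → S ⊆ˡ L σ → length S ≤ a → ∃ λ σ′ → S ⊆ˡ L σ′ × ¬ (L σ ≐ L σ′))
  where

  -- Strong induction on the layer `i`. A teaching set of `L σ` in layer `i` also lies in a
  -- different `L σ′`, which some layer `i′` must contain: `i ≤ i′` violates the teaching condition,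
  -- and `i′ < i` the induction hypothesis.
  no-layer : ∀ i → V i → ∀ j σ → ¬ (F i j ≐ L σ)
  no-layer = <-rec (λ i → V i → ∀ j σ → ¬ (F i j ≐ L σ)) step
    where
    step : ∀ i → (∀ {i′} → i′ < i → V i′ → ∀ j σ → ¬ (F i′ j ≐ L σ)) →
           V i → ∀ j σ → ¬ (F i j ≐ L σ)
    step i earlier v j σ same with teachable i v j
    ... | S , _ , size , S⊆ , separates
      with not-taught {σ} (mapᵃ (λ {y} → proj₁ (same y)) S⊆)
                          (≤-trans (≤-reflexive size) (order i v))
    ...   | σ′ , S⊆′ , differ with covers σ′
    ...     | i′ , v′ , j′ , same′ = later (<-cmp i′ i)
      where
      not-later : ¬ (i ≤ i′)
      not-later i≤i′ = differ (≐-trans (≐-sym same) (≐-trans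
        (separates i′ j′ v′ i≤i′ (mapᵃ (λ {y} → proj₂ (same′ y)) S⊆′)) same′))
      later : _ → ⊥
      later (tri< i′<i _ _) = earlier i′<i v′ j′ σ′ same′
      later (tri≈ _ refl _) = not-later ≤-refl
      later (tri> _ _ i<i′) = not-later (<⇒≤ i<i′)

  no-teaching-sequence : ⊥
  no-teaching-sequence = let i , v , j , same = covers 0 in no-layer i v j 0 same

-- Finite sets coded in binary, and a finite pigeonhole argument.

bit-above : ∀ m {s} → s ≤ m → bit m s ≡ 0
bit-above zero    z≤n = refl
bit-above (suc m) {zero}  _         = bit-above m z≤n
bit-above (suc m) {suc s} (s≤s s≤m) = bit-above m (≤-trans (≤-pred (⌊n/2⌋<n s)) s≤m)

-- `p + (h + h)` puts the bit `p` below the binary digits of `h`; `flip-bit` uses it to reassemble a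
-- number after changing one digit.
parity-half-cons : ∀ {p} h → Bit p → parity (p + (h + h)) ≡ p × ⌊ p + (h + h) /2⌋ ≡ h
parity-half-cons h 0ᵇ = even h , sym (n≡⌊n+n/2⌋ h)
  where
  even : ∀ h → parity (h + h) ≡ 0
  even zero    = refl
  even (suc h) = trans (cong (λ n → 1 ∸ parity n) (+-suc h h)) (cong (λ p → 1 ∸ (1 ∸ p)) (even h))
parity-half-cons h 1ᵇ with parity-half-cons h 0ᵇ
... | even , half = cong (1 ∸_) even ,
  trans (sym (half-suc (h + h))) (trans (cong (_+ ⌊ h + h /2⌋) even) half)

flip-bit : ∀ l s → ∃ λ s′ → bit l s ≢ bit l s′ × (∀ m → m ≢ l → bit m s ≡ bit m s′)
flip-bit zero s = s′ , flipped , kept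
  where
  h  = ⌊ s /2⌋
  s′ = (1 ∸ parity s) + (h + h)
  -- `parity (suc s)` unfolds to `1 ∸ parity s`, the flipped lowest bit.
  bits = parity-half-cons h (parity-bit (suc s))
  flipped : parity s ≢ parity s′
  flipped eq with parity s | parity-bit s | trans eq (proj₁ bits)
  ... | _ | 0ᵇ | ()
  ... | _ | 1ᵇ | ()
  kept : ∀ m → m ≢ 0 → bit m s ≡ bit m s′
  kept zero    0≢0 = contradiction refl 0≢0
  kept (suc m) _   = cong (bit m) (sym (proj₂ bits))
flip-bit (suc l) s with flip-bit l ⌊ s /2⌋
... | t , flipped , kept = s′ , flipped′ , kept′
  where
  s′ = parity s + (t + t)
  bits = parity-half-cons t (parity-bit s)
  flipped′ : bit l ⌊ s /2⌋ ≢ bit l ⌊ s′ /2⌋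
  flipped′ eq = flipped (trans eq (cong (bit l) (proj₂ bits)))
  kept′ : ∀ m → m ≢ suc l → bit m s ≡ bit m s′
  kept′ zero    _   = sym (proj₁ bits)
  kept′ (suc m) m≢l = trans (kept m (m≢l ∘ cong suc)) (cong (bit m) (sym (proj₂ bits)))

-- If each of the `suc a` candidates had a position in `ks`, two would share one and hence be equal.
fresh : ∀ (ks : List ℕ) {a} → length ks ≤ a → ∃ λ k → k ≤ a × k ∉ ks
fresh ks {a} len≤a with ¬∀⟶∃¬ (suc a) (λ i → toℕ i ∈ ks) (λ i → toℕ i ∈? ks) not-all
  where
  not-all : ¬ (∀ (i : Fin (suc a)) → toℕ i ∈ ks)
  not-all all∈ with pigeonhole (s≤s len≤a) (λ i → index (all∈ i))
  ... | i , j , i<j , same = <⇒≢ᶠ i<j (toℕ-injective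
    (trans (lookup-index (all∈ i)) (trans (cong (lookupˡ ks) same) (sym (lookup-index (all∈ j))))))
... | i , i∉ks = toℕ i , ≤-pred (toℕ<n i) , i∉ks

-- Classical principles.

module Classical (em : ExcludedMiddle 0ℓ) where

  ¬∀⇒∃¬ : ∀ {P : ℕ → Set} → ¬ (∀ n → P n) → ∃ λ n → ¬ P n
  ¬∀⇒∃¬ ¬∀ = decidable-stable em λ ¬∃ → ¬∀ λ n → decidable-stable em λ ¬P → ¬∃ (n , ¬P)

  -- If the candidate `K` fails at some `n₀`, it fails at every larger `n` too. Asking at `n ⊔ n₀`
  -- instead of `n` therefore yields a candidate below `K`, and the induction continues.
  infinite-pigeonhole : (P : ℕ → ℕ → Set) → (∀ {k m n} → m ≤ n → P k n → P k m) →
    ∀ K → (∀ n → ∃ λ k → k < K × P k n) → ∃ λ k → k < K × (∀ n → P k n)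
  infinite-pigeonhole P anti zero    h with h 0
  ... | _ , () , _
  infinite-pigeonhole P anti (suc K) h with em {∀ n → P K n}
  ... | yes all = K , ≤-refl , all
  ... | no ¬all with infinite-pigeonhole P anti K below
    where
    n₀ = proj₁ (¬∀⇒∃¬ ¬all)
    below : ∀ n → ∃ λ k → k < K × P k n
    below n with h (n ⊔ n₀)
    ... | k , k<1+K , p with m≤n⇒m<n∨m≡n (≤-pred k<1+K)
    ...   | inj₁ k<K  = k , k<K , anti (m≤m⊔n n n₀) p
    ...   | inj₂ refl = contradiction (anti (m≤n⊔m n n₀) p) (proj₂ (¬∀⇒∃¬ ¬all))
  ...   | k , k<K , all = k , m≤n⇒m≤1+n k<K , all

-- The languages of a component.

element : ℕ → ℕ → ℕ → ℕ → ℕ → ℕ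
element a B τ k r = pair a (pair B (pair τ (pair k r)))

element-injective : ∀ a a′ B B′ τ τ′ k k′ {r r′} → element a B τ k r ≡ element a′ B′ τ′ k′ r′ →
  a ≡ a′ × B ≡ B′ × τ ≡ τ′ × k ≡ k′ × r ≡ r′
element-injective a a′ B B′ τ τ′ k k′ eq with triple-injective a a′ B B′ eq
... | a≡ , B≡ , eq′ = a≡ , B≡ , triple-injective τ τ′ k k′ eq′

module Languages (Progress : (a B c n : ℕ) → Set) where

  -- σ and τ are finite sets of labels l = ⟨c,k′,n⟩, coded in binary.
  Agree : (a B σ τ k r l : ℕ) → Set
  Agree a B σ τ k r l = bit l σ ≡ bit l τ ⊎
    ∃ λ n → ∃ λ k′ → ∃ λ c → l ≡ triple c k′ n ×
      (Progress a B c n ⊎ a < k′ ⊎ (r < c × (k < k′ ⊎ k′ < k)))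

  -- From `σ + τ` on all bits of both numbers are 0, so the bound loses no label; it keeps
  -- membership semidecidable.
  Member : (a B σ τ k r : ℕ) → Set
  Member a B σ τ k r = ∀ l → l < σ + τ → Agree a B σ τ k r l

  -- In the terms of the overview: `σ` and `σ′` differ only in dead labels.
  Settled : (a B σ σ′ : ℕ) → Set
  Settled a B σ σ′ = ∀ l → bit l σ ≡ bit l σ′ ⊎
    ∃ λ n → ∃ λ k → ∃ λ c → l ≡ triple c k n × (Progress a B c n ⊎ a < k)

  Language : (a B σ : ℕ) → ℕ → Set
  Language a B σ y = ∃ λ τ → ∃ λ k → ∃ λ r → y ≡ element a B τ k r × Member a B σ τ k r

  bits-beyond : ∀ {σ τ l} → ¬ (l < σ + τ) → bit l σ ≡ bit l τ
  bits-beyond {σ} {τ} {l} l≮ =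
    trans (bit-above l (≤-trans (m≤m+n σ τ) (≮⇒≥ l≮)))
          (sym (bit-above l (≤-trans (m≤n+m τ σ) (≮⇒≥ l≮))))

  agree-everywhere : ∀ {a B σ τ k r} → Member a B σ τ k r → ∀ l → Agree a B σ τ k r l
  agree-everywhere {σ = σ} {τ} m l with l <? σ + τ
  ... | yes l< = m l l<
  ... | no  l≮ = inj₁ (bits-beyond l≮)

  settled-sym : ∀ {a B σ σ′} → Settled a B σ σ′ → Settled a B σ′ σ
  settled-sym s l = map₁ sym (s l)

  -- Dead labels are tolerated by every element, whatever its `k` and `r`; on all other labels `σ`
  -- and `σ′` have equal bits.
  settled⇒⊆ : ∀ {a B σ σ′} → Settled a B σ σ′ → ∀ {y} → Language a B σ y → Language a B σ′ y
  settled⇒⊆ {a} {B} {σ} {σ′} s (τ , k , r , y≡ , m) = τ , k , r , y≡ , λ l _ → agree l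
    where
    agree : ∀ l → Agree a B σ′ τ k r l
    agree l with s l
    ... | inj₁ σ≡σ′ = map₁ (trans (sym σ≡σ′)) (agree-everywhere m l)
    ... | inj₂ (n , k′ , c , l≡ , inj₁ p) = inj₂ (n , k′ , c , l≡ , inj₁ p)
    ... | inj₂ (n , k′ , c , l≡ , inj₂ q) = inj₂ (n , k′ , c , l≡ , inj₂ (inj₁ q))

  settled⇒≐ : ∀ {a B σ σ′} → Settled a B σ σ′ → Language a B σ ≐ Language a B σ′
  settled⇒≐ s y = settled⇒⊆ s , settled⇒⊆ (settled-sym s)

  own-element : ∀ {a B σ} k r → Language a B σ (element a B σ k r)
  own-element k r = _ , k , r , refl , λ _ _ → inj₁ refl

  -- A label ⟨c,k′,n⟩ with k′ ≤ a is not tolerated by the element with k = k′.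
  settled-by-all-k : ∀ {a B σ σ′ r} → (∀ k → k ≤ a → Member a B σ′ σ k r) → Settled a B σ σ′
  settled-by-all-k {a} {B} {σ} {σ′} m l with agree-everywhere (m 0 z≤n) l
  ... | inj₁ σ′≡σ = inj₁ (sym σ′≡σ)
  ... | inj₂ (n , k′ , c , l≡ , inj₁ p) = inj₂ (n , k′ , c , l≡ , inj₁ p)
  ... | inj₂ (n , k′ , c , l≡ , inj₂ (inj₁ q)) = inj₂ (n , k′ , c , l≡ , inj₂ q)
  ... | inj₂ (n , k′ , c , refl , inj₂ (inj₂ _)) with k′ ≤? a
  ...   | no k′≰a = inj₂ (n , k′ , c , refl , inj₂ (≰⇒> k′≰a))
  ...   | yes k′≤a with agree-everywhere (m k′ k′≤a) (triple c k′ n)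
  ...     | inj₁ σ′≡σ = inj₁ (sym σ′≡σ)
  ...     | inj₂ (n₂ , k₂ , c₂ , l≡ , inj₁ p) = inj₂ (n₂ , k₂ , c₂ , l≡ , inj₁ p)
  ...     | inj₂ (n₂ , k₂ , c₂ , l≡ , inj₂ (inj₁ q)) = inj₂ (n₂ , k₂ , c₂ , l≡ , inj₂ q)
  ...     | inj₂ (n₂ , k₂ , c₂ , l≡ , inj₂ (inj₂ (_ , k′≶k₂)))
    with refl ← proj₁ (proj₂ (triple-injective c c₂ k′ k₂ l≡)) with k′≶k₂
  ...       | inj₁ k′<k′ = contradiction k′<k′ (<-irrefl refl)
  ...       | inj₂ k′<k′ = contradiction k′<k′ (<-irrefl refl)

  -- Besides dead labels, an element tolerates only labels with `r < c`, and beyond `r` every label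
  -- is dead by hypothesis.
  settled-by-large-r : ∀ {a B σ σ′ k r} → (∀ c → r < c → ∀ n → Progress a B c n) →
    Member a B σ′ σ k r → Settled a B σ σ′
  settled-by-large-r good m l with agree-everywhere m l
  ... | inj₁ σ′≡σ = inj₁ (sym σ′≡σ)
  ... | inj₂ (n , k′ , c , l≡ , inj₁ p) = inj₂ (n , k′ , c , l≡ , inj₁ p)
  ... | inj₂ (n , k′ , c , l≡ , inj₂ (inj₁ q)) = inj₂ (n , k′ , c , l≡ , inj₂ q)
  ... | inj₂ (n , k′ , c , l≡ , inj₂ (inj₂ (r<c , _))) =
    inj₂ (n , k′ , c , l≡ , inj₁ (good c r<c n))

  -- Teaching the whole family in a single layer.

  module Positive (a₀ : ℕ) (threshold : ℕ → ℕ)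
    (good-progress : ∀ {a} → a₀ ≤ a → ∀ B c → threshold B < c → ∀ n → Progress a B c n) where

    radius : ℕ → ℕ → ℕ
    radius a B with a <? a₀
    -- A default: below `a₀` the separation comes from the range of `k`.
    ... | yes _ = 0
    ... | no  _ = threshold B

    -- The size `suc a₀` is the same in every component, as a layer has one `d`. For `a < a₀` the
    -- range of `k` includes all `k ≤ a`; for `a₀ ≤ a` a single element with a large `r` already
    -- separates.
    teaching-set : (a B σ : ℕ) → List ℕ
    teaching-set a B σ = mapˡ (λ k → element a B σ k (radius a B)) (upTo (suc a₀))

    teaching-set⇒settled : ∀ {a B σ σ′} →
      (∀ k → k ≤ a₀ → Member a B σ′ σ k (radius a B)) → Settled a B σ σ′
    teaching-set⇒settled {a} {B} m with a <? a₀
    ... | yes a<a₀ = settled-by-all-k λ k k≤a → m k (≤-trans k≤a (<⇒≤ a<a₀))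
    ... | no  a≮a₀ = settled-by-large-r (good-progress (≮⇒≥ a≮a₀) B) (m 0 z≤n)

    -- An element carries `a` and `B` in its code, so only languages of the same component can
    -- contain the set.
    teaches : ∀ {a B σ a′ B′ σ′} → teaching-set a B σ ⊆ˡ Language a′ B′ σ′ →
              Language a B σ ≐ Language a′ B′ σ′
    teaches {a} {B} {σ} {a′} {B′} {σ′} S⊆ = conclude (members 0 z≤n)
      where
      members : ∀ k → k ≤ a₀ → a ≡ a′ × B ≡ B′ × Member a′ B′ σ′ σ k (radius a B)
      members k k≤a₀ with lookupᵃ (map⁻ S⊆) (∈-upTo⁺ (s≤s k≤a₀))
      ... | τ , k₂ , r₂ , eq , m with element-injective a a′ B B′ σ τ k k₂ eq
      ...   | refl , refl , refl , refl , refl = refl , refl , m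
      conclude : a ≡ a′ × B ≡ B′ × _ → Language a B σ ≐ Language a′ B′ σ′
      conclude (refl , refl , _) =
        settled⇒≐ (teaching-set⇒settled λ k k≤a₀ → proj₂ (proj₂ (members k k≤a₀)))

    module _ {e w : ℕ} (Le≐Language : ∀ a B σ → Le e (triple a B σ) ≐ Language a B σ)
             (Fam≐Le : ∀ j → Fam w 0 j ≐ Le e j) where

      Fam≐Language : ∀ a B σ → Fam w 0 (triple a B σ) ≐ Language a B σ
      Fam≐Language a B σ = ≐-trans (Fam≐Le (triple a B σ)) (Le≐Language a B σ)

      Rure-e : Rure e
      Rure-e = w , just 1 , (λ _ → suc a₀) , (within , covers , disjoint , teachable) ,
               suc a₀ , λ _ _ → ≤-refl
        where
        within : ∀ i → i < 1 → ∀ j → ∃ λ k → Fam w i j ≐ Le e k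
        within _ (s≤s z≤n) j = j , Fam≐Le j
        covers : ∀ k → ∃ λ i → i < 1 × ∃ λ j → Le e k ≐ Fam w i j
        covers k = 0 , s≤s z≤n , k , ≐-sym (Fam≐Le k)
        disjoint : ∀ i i′ j j′ → i < 1 → i′ < 1 → Fam w i j ≐ Fam w i′ j′ → i ≡ i′
        disjoint _ _ _ _ (s≤s z≤n) (s≤s z≤n) _ = refl
        teachable : ∀ i → i < 1 → ∀ j → ∃ λ S → Unique S × length S ≡ suc a₀ × S ⊆ˡ Fam w i j ×
          (∀ i′ j′ → i′ < 1 → i ≤ i′ → S ⊆ˡ Fam w i′ j′ → Fam w i j ≐ Fam w i′ j′)
        teachable _ (s≤s z≤n) j with triple-surjective j
        ... | a , B , σ , refl = teaching-set a B σ ,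
          Unique.map⁺ (λ {k} {k′} eq → proj₁ (proj₂ (proj₂ (proj₂
            (element-injective a a B B σ σ k k′ eq))))) (Unique.upTo⁺ (suc a₀)) ,
          trans (length-map _ (upTo (suc a₀))) (length-upTo (suc a₀)) ,
          map⁺ (universal (λ k → proj₂ (Fam≐Language a B σ _) (own-element k _)) (upTo (suc a₀))) ,
          separates
          where
          separates : ∀ i′ j′ → i′ < 1 → 0 ≤ i′ → teaching-set a B σ ⊆ˡ Fam w i′ j′ →
                      Fam w 0 (triple a B σ) ≐ Fam w i′ j′
          separates _ j′ (s≤s z≤n) _ S⊆ with triple-surjective j′
          ... | a′ , B′ , σ′ , refl =
            ≐-trans (Fam≐Language a B σ) (≐-trans
              (teaches {a} {B} {σ} {a′} {B′} {σ′} (mapᵃ (λ {y} → proj₁ (Fam≐Language a′ B′ σ′ y)) S⊆))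
              (≐-sym (Fam≐Language a′ B′ σ′)))

  -- Components that cannot be taught with order `a`.

  module Negative (a B : ℕ) (bad : ∀ c → ∃ λ n → ¬ Progress a B c n) where

    flip-keeps-member : ∀ {σ σ′ τ k r c k′ n} → r < c → k ≢ k′ →
      (∀ m → m ≢ triple c k′ n → bit m σ ≡ bit m σ′) →
      Member a B σ τ k r → Member a B σ′ τ k r
    flip-keeps-member {k = k} {c = c} {k′} {n} r<c k≢k′ kept mem l _ with l ≟ triple c k′ n
    ... | yes l≡ = inj₂ (n , k′ , c , l≡ , inj₂ (inj₂ (r<c , ≶ (<-cmp k k′))))
      where
      ≶ : _ → k < k′ ⊎ k′ < k
      ≶ (tri< k<k′ _ _) = inj₁ k<k′
      ≶ (tri≈ _ k≡k′ _) = contradiction k≡k′ k≢k′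
      ≶ (tri> _ _ k′<k) = inj₂ k′<k
    ... | no  l≢ = map₁ (trans (sym (kept l l≢))) (agree-everywhere mem l)

    -- `ks` lists the `k` of the elements of `S`, and `R` exceeds all their `r`; hence every element
    -- of `S` tolerates a label with `k′` outside `ks` and `R ≤ c`.
    finite-part-kept : ∀ {σ S} → S ⊆ˡ Language a B σ → ∃₂ λ ks R → length ks ≡ length S ×
      (∀ {σ′ c k′ n} → k′ ∉ ks → R ≤ c → (∀ m → m ≢ triple c k′ n → bit m σ ≡ bit m σ′) →
       S ⊆ˡ Language a B σ′)
    finite-part-kept [] = [] , 0 , refl , λ _ _ _ → []
    finite-part-kept ((τ , k , r , y≡ , mem) ∷ rest) with finite-part-kept rest
    ... | ks , R , len , keep = k ∷ ks , suc r + R , cong suc len , λ k′∉ R≤c kept →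
      (τ , k , r , y≡ , flip-keeps-member (≤-trans (m≤m+n (suc r) R) R≤c) (k′∉ ∘ here ∘ sym) kept mem)
      ∷ keep (k′∉ ∘ there) (≤-trans (m≤n+m R (suc r)) R≤c) kept

    not-taught : ∀ {σ S} → S ⊆ˡ Language a B σ → length S ≤ a →
      ∃ λ σ′ → S ⊆ˡ Language a B σ′ × ¬ (Language a B σ ≐ Language a B σ′)
    not-taught {σ} {S} S⊆ len≤a with finite-part-kept S⊆
    -- `S` has at most `a` elements, so it misses some `k′ ≤ a`; the choice of `n` by `bad R` makes
    -- the label `⟨R,k′,n⟩` not dead.
    ... | ks , R , len , keep with fresh ks (≤-trans (≤-reflexive len) len≤a) | bad R
    ...   | k′ , k′≤a , k′∉ | n , stuck with flip-bit (triple R k′ n) σ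
    ...     | σ′ , flipped , kept = σ′ , keep k′∉ ≤-refl kept , differ
      where
      differ : ¬ (Language a B σ ≐ Language a B σ′)
      -- The element of `σ′` with this very `k′` lies in the second language and does not tolerate
      -- the flipped label.
      differ same with proj₂ (same (element a B σ′ k′ 0)) (own-element k′ 0)
      ... | τ , k , r , eq , mem with element-injective a a B B σ′ τ k′ k eq
      ...   | _ , _ , refl , refl , _ with agree-everywhere mem (triple R k′ n)
      ...     | inj₁ σ≡σ′ = flipped σ≡σ′
      ...     | inj₂ (n₂ , k₂ , c₂ , l≡ , why) with triple-injective R c₂ k′ k₂ l≡
      ...       | refl , refl , refl with why
      ...         | inj₁ p                         = stuck p
      ...         | inj₂ (inj₁ a<k′)               = <-irrefl refl (≤-trans a<k′ k′≤a)
      ...         | inj₂ (inj₂ (_ , inj₁ k′<k′))   = <-irrefl refl k′<k′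
      ...         | inj₂ (inj₂ (_ , inj₂ k′<k′))   = <-irrefl refl k′<k′

    no-sequence-of-order-a : ∀ {e w len d} → (∀ σ → Le e (triple a B σ) ≐ Language a B σ) →
      IsPosTeachSeq e w len d → (∀ i → Valid len i → d i ≤ a) → ⊥
    no-sequence-of-order-a {e} {w} {len} {d} Le≐Language (_ , covers , _ , teachable) order =
      no-teaching-sequence a (Fam w) (Valid len) d order teachable (Language a B) covers′ not-taught
      where
      covers′ : ∀ σ → ∃ λ i → Valid len i × ∃ λ j → Fam w i j ≐ Language a B σ
      covers′ σ = let i , v , j , Le≐Fam = covers (triple a B σ) in
        i , v , j , ≐-trans (≐-sym Le≐Fam) (Le≐Language σ)

-- Abstract, since codes of concrete programs are too large to be unfolded.
abstract
  numbering : (φ : Formula 2) →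
    Σ (Fun 1) λ g → ∀ x y → W (val g (x ∷ [])) y ⇔ ⟦ φ ⟧ (x ∷ y ∷ [])
  numbering φ = specialiseCodeF (semidecide φ) , λ x y →
    let to , from = W-specialise (semidecide φ) x y in
    (λ w → semidecide-sound φ (proj₂ (to w))) , from ∘ semidecide-complete φ

-- The reduction and its correctness.

module Reduction (f : PR 6) (total : Total f) where

  matrix : Fun 6
  matrix .prog    = f
  matrix .val     = proj₁ ∘ total
  matrix .correct = proj₂ ∘ total

  sucᶠ : ∀ {n} → Fun n → Fun n
  sucᶠ F = sucF ∙ (F ∷ [])
  pairᶠ : ∀ {n} → Fun n → Fun n → Fun n
  pairᶠ F G = pairF ∙ (F ∷ G ∷ [])
  bitᶠ : ∀ {n} → Fun n → Fun n → Fun n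
  bitᶠ F G = bitF ∙ (F ∷ G ∷ [])

  -- Variables: x, a, B, c, n.
  progress : Formula 5
  progress =
    exists (var 0F ≺ sucᶠ (var 2F) ∧ forall< (sucᶠ (var 3F))
      (exists (var 0F ≺ sucᶠ (var 6F) ∧ forall< (var 7F)
        (exists (matrix ∙ (var 5F ∷ var 4F ∷ var 3F ∷ var 2F ∷ var 1F ∷ var 0F ∷ []) ≈ const 0)))))

  -- Variables: x, a, B, σ, τ, k, r.
  member : Formula 7
  member =
    forall< (addF ∙ (var 3F ∷ var 4F ∷ []))
      (bitᶠ (var 0F) (var 4F) ≈ bitᶠ (var 0F) (var 5F)
      ∨ exists (exists (exists
          (var 3F ≈ pairᶠ (var 0F) (pairᶠ (var 1F) (var 2F)) ∧
          (progress [ var 4F ∷ var 5F ∷ var 6F ∷ var 0F ∷ var 2F ∷ [] ]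
          ∨ var 5F ≺ var 1F
          ∨ var (suc 9F) ≺ var 0F ∧ (var 9F ≺ var 1F ∨ var 1F ≺ var 9F))))))

  -- Variables: x, y; bound, innermost first: a, B, σ, τ, k, r.
  family : Formula 2
  family = exists (exists (exists (exists (exists (exists
    (var 7F ≈ pairᶠ (pairᶠ (var 0F) (pairᶠ (var 1F) (var 2F)))
                    (pairᶠ (var 0F) (pairᶠ (var 1F) (pairᶠ (var 3F) (pairᶠ (var 4F) (var 5F)))))
    ∧ member [ var 6F ∷ var 0F ∷ var 1F ∷ var 2F ∷ var 3F ∷ var 4F ∷ var 5F ∷ [] ]))))))

  -- Every index is prefixed with the layer number 0, so that layer 0 of the resulting sequence is
  -- the whole family.
  single-layer : Formula 2
  single-layer = exists
    (var 2F ≈ pairᶠ (const 0) (var 0F) ∧ family [ var 1F ∷ var 0F ∷ [] ])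

  module Instance (x e w : ℕ)
    (W-e : ∀ y → W e y ⇔ ⟦ family ⟧ (x ∷ y ∷ []))
    (W-w : ∀ y → W w y ⇔ ⟦ single-layer ⟧ (x ∷ y ∷ [])) where

    Progress : (a B c n : ℕ) → Set
    Progress a B c n = ⟦ progress ⟧ (x ∷ a ∷ B ∷ c ∷ n ∷ [])

    open Languages Progress

    Le≐Language : ∀ a B σ → Le e (triple a B σ) ≐ Language a B σ
    Le≐Language a B σ y = to , from
      where
      to : Le e (triple a B σ) y → Language a B σ y
      to h with proj₁ (W-e _) h
      ... | r , k , τ , σ′ , B′ , a′ , eq , m
        with pair-injective (triple a B σ) (triple a′ B′ σ′) eq
      ...   | j≡ , refl with triple-injective a a′ B B′ j≡
      -- `m` is passed on unchanged: the meaning of `member` unfolds to `Member`.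
      ...     | refl , refl , refl = τ , k , r , refl , m
      from : Language a B σ y → Le e (triple a B σ) y
      from (τ , k , r , refl , m) =
        proj₂ (W-e _) (r , k , τ , σ , B , a , refl , m)

    Fam≐Le : ∀ j → Fam w 0 j ≐ Le e j
    Fam≐Le j y = to , from
      where
      to : Fam w 0 j y → Le e j y
      to h with proj₁ (W-w _) h
      ... | z , eq , m with refl ← proj₂ (pair-injective 0 0 {pair j y} {z} eq) =
        proj₂ (W-e _) m
      from : Le e j y → Fam w 0 j y
      from h = proj₂ (W-w _) (pair j y , refl , proj₁ (W-e _) h)

    Σ₅ : Set
    Σ₅ = ∃ λ a → ∀ b → ∃ λ c → ∀ d → ∃ λ u → val matrix (x ∷ a ∷ b ∷ c ∷ d ∷ u ∷ []) ≡ 0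

    Σ₅⇒Rure : Σ₅ → Rure e
    Σ₅⇒Rure (a₀ , good) = Positive.Rure-e a₀ threshold good-progress Le≐Language Fam≐Le
      where
      threshold : ℕ → ℕ
      -- A common bound for the chosen witnesses `c` of all `b ≤ B`; the argument is `suc B` because
      -- `upper-bound` ranges over indices strictly below it.
      threshold B = proj₁ (upper-bound (λ b → proj₁ (good b)) (suc B))

      good-progress : ∀ {a} → a₀ ≤ a → ∀ B c → threshold B < c → ∀ n → Progress a B c n
      -- `a₀` itself serves as `a′` for every `a ≥ a₀`.
      good-progress a₀≤a B c B<c n = a₀ , s≤s a₀≤a , λ b b≤B →
        proj₁ (good b) ,
        s≤s (≤-trans (proj₂ (upper-bound (λ b → proj₁ (good b)) (suc B)) b b≤B) (<⇒≤ B<c)) ,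
        λ d _ → proj₂ (good b) d

    module _ (em : ExcludedMiddle 0ℓ) where
      open Classical em

      -- `Progress` lets `a′ ≤ a` and `c′ ≤ c` vary with `n` and `B`. The pigeonhole principle fixes
      -- them in turn: `a′` for a given `B` as `n` grows, then `c′` for each `b ≤ B`, and finally
      -- one `a′` for all `B`.
      progress-everywhere : ∀ a → (∀ B → ∃ λ c → ∀ n → Progress a B c n) → Σ₅
      progress-everywhere a always = a′ , λ b → proj₂ (proj₂ choice-a) b b ≤-refl
        where
        Inner : ℕ → ℕ → ℕ → ℕ → Set
        Inner a′ b c n = ∀ d → d < n → ∃ λ u → val matrix (x ∷ a′ ∷ b ∷ c ∷ d ∷ u ∷ []) ≡ 0
        inner-antitone : ∀ {a′ b c m n} → m ≤ n → Inner a′ b c n → Inner a′ b c m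
        inner-antitone m≤n h d d<m = h d (≤-trans d<m m≤n)
        GoodBelow : ℕ → ℕ → Set
        GoodBelow a′ B = ∀ b → b < suc B → ∃ λ c → ∀ d → ∃ λ u →
          val matrix (x ∷ a′ ∷ b ∷ c ∷ d ∷ u ∷ []) ≡ 0
        below : ∀ B → ∃ λ a′ → a′ < suc a × GoodBelow a′ B
        below B with always B
        ... | c , all-n with infinite-pigeonhole
              (λ a′ n → ∀ b → b < suc B → ∃ λ c′ → c′ < suc c × Inner a′ b c′ n)
              (λ m≤n h b b≤B → let c′ , c′≤c , i = h b b≤B in c′ , c′≤c , inner-antitone m≤n i)
              (suc a) all-n
        ...   | a′ , a′≤a , h = a′ , a′≤a , λ b b≤B →
          let c′ , _ , i = infinite-pigeonhole (λ c′ n → Inner a′ b c′ n) inner-antitone (suc c)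
                             (λ n → h n b b≤B)
          -- `Inner` bounds `d` strictly, hence `suc d`.
          in c′ , λ d → i (suc d) d ≤-refl
        choice-a = infinite-pigeonhole GoodBelow
          (λ B≤B′ h b b≤B → h b (≤-trans b≤B (s≤s B≤B′))) (suc a) below
        a′ = proj₁ choice-a

      -- The bound `D` on the order selects the components with `a = D`. Were some `(D,B)` without
      -- progress for every `c`, the sequence could not exist; so each `B` has a `c` with progress
      -- at all `n`, and `progress-everywhere` applies.
      Rure⇒Σ₅ : Rure e → Σ₅
      Rure⇒Σ₅ (w′ , len , d , seq , D , order)
        with em {∃ λ B → ∀ c → ∃ λ n → ¬ Progress D B c n}
      ... | yes (B , bad) = ⊥-elim (
          Negative.no-sequence-of-order-a D B bad (Le≐Language D B) seq order)
      ... | no ¬bad = progress-everywhere D λ B → decidable-stable em λ none →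
        ¬bad (B , λ c → ¬∀⇒∃¬ λ all → none (c , all))

theorem13 : ExcludedMiddle 0ℓ → Σ⁰₅-hard Rure
theorem13 em A (f , total , A⇔) = prog g , (λ xs → val g xs , correct g xs) , reduces
  where
  open Reduction f total
  g = proj₁ (numbering family)
  h = proj₁ (numbering single-layer)
  reduces : ∀ x y → Eval (prog g) (x ∷ []) y → A x ⇔ Rure y
  -- The equivalence is required at any output `y` of the program; determinism identifies `y` with
  -- the value of `g`.
  reduces x y run = subst (λ y → A x ⇔ Rure y)
    (Eval-deterministic (prog g) (correct g (x ∷ [])) run) (to , from)
    where
    open Instance x (val g (x ∷ [])) (val h (x ∷ []))
      (proj₂ (numbering family) x) (proj₂ (numbering single-layer) x)
    to : A x → Rure (val g (x ∷ []))
    to Ax with proj₁ (A⇔ x) Ax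
    ... | a , p = Σ₅⇒Rure (a , λ b → let c , q = p b in c , λ d → let u , run = q d in
      u , Eval-deterministic f (correct matrix _) run)
    from : Rure (val g (x ∷ [])) → A x
    from r with Rure⇒Σ₅ em r
    ... | a , p = proj₂ (A⇔ x) (a , λ b → let c , q = p b in c , λ d → let u , ≡0 = q d in
      u , subst (Eval f _) ≡0 (correct matrix _))
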